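{- Let $S_8=(s_0,s_1,\dots,s_{23})$ be the sequence $$(8,7,6,5,4,3,\ 8,7,6,5,4,3,\ 4,3,2,1,0,-1,\ 4,3,2,1,0,-1).$$ Let $\varphi_8:\mathbb{N}\to\mathbb{N}$ be the function defined as follows. The values $\varphi_8(0),\varphi_8(1),\dots,\varphi_8(63)$ are, in order (ten per row), $$\begin{array}{l}6,7,8,9,10,11,0,1,2,3,\\ 4,5,16,17,22,23,12,13,20,21,\\ 18,19,14,15,30,31,32,33,34,35,\\ 24,25,26,27,28,29,40,41,44,45,\\ 36,37,48,49,38,39,52,53,42,43,\\ 56,57,46,47,60,61,50,51,62,63,\\ 54,55,58,59,\end{array}$$ and for $x\ge 64$, $$\varphi_8(x)=x\oplus_{s_{x-64}}6=\bigl((x+s_{x-64})\oplus 6\bigr)-s_{x-64},$$ where the index $x-64$ is taken modulo $24$. Then, for all nonnegative integers $a,b$, the Halve Nim position $a^1b^18^1$ is a $\mathcal{P}$-position if and only if $b=\varphi_8(a)$.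
   Context: $\mathbb{N}$ is the set of nonnegative integers and $\oplus$ denotes bitwise XOR. The $n$-shifted bitwise sum, for an integer $n$, is $x\oplus_n y=\bigl((x+n)\oplus y\bigr)-n$. Halve Nim is a two-player game played on finitely many piles of coins; players alternate moves and a player who cannot move loses. A move is one of: (i) choose one pile and remove at least one coin from it; (ii) halve the game: simultaneously replace every pile of $m$ coins by a pile of $\lfloor m/2\rfloor$ coins. When there are no coins left, no move is available (halving requires at least one coin to be present). A position is a $\mathcal{P}$-position if the player who is not about to move has a winning strategy (equivalently, every move from it leads to an $\mathcal{N}$-position), and an $\mathcal{N}$-position if the player about to move has a winning strategy. $a^1b^1c^1$ denotes the position with three piles of sizes $a$, $b$, $c$ (a pile of size $0$ is an empty pile); in particular $a^1b^18^1$ has piles of sizes $a$, $b$, $8$. -}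

module Defs where

open import Data.Fin.Base using (fromℕ<)
import Data.Integer.Base as ℤ
open ℤ using (ℤ; +_; -[1+_]; ∣_∣)
import Data.Integer.Properties as ℤ
open import Data.Integer.Solver using (module +-*-Solver)
open import Data.List.Base using (List; lookup; map; _[_]∷=_)
open import Data.List.Relation.Unary.Any using (Any)
open import Data.Nat
open import Data.Nat.DivMod
open import Data.Nat.Properties
open import Data.Nat.Solver using () renaming (module +-*-Solver to ℕ-Solver)
open import Data.Product.Base using (∃; _×_; _,_)
open import Data.Vec.Base as Vec using (Vec; []; _∷_)
open import Data.Vec.Relation.Unary.All as All using (All)
open import Data.Vec.Relation.Unary.All.Properties using (lookup⁺)
open import Relation.Binary.PropositionalEquality
open import Relation.Nullary using (yes; no; contradiction)
open import Relation.Nullary.Decidable using (from-yes)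

Position : Set
Position = List ℕ

infix 4 _⟶_

data _⟶_ (p : Position) : Position → Set where
  remove : ∀ i {m} → m < lookup p i → p ⟶ p [ i ]∷= m
  halve  : Any (0 <_) p → p ⟶ map ⌊_/2⌋ p

-- Inductive, so an element of 𝒩 p is a winning strategy for the player
-- about to move, and an element of 𝒫 p one for the other player.

data 𝒫 (p : Position) : Set
data 𝒩 (p : Position) : Set

data 𝒫 p where
  every-move : (∀ {q} → p ⟶ q → 𝒩 q) → 𝒫 p

data 𝒩 p where
  some-move : ∃ (λ q → (p ⟶ q) × 𝒫 q) → 𝒩 p

-- XOR of the k lowest bits; the XOR of two bits is their sum modulo 2.
xorBits : (k m n : ℕ) → ℕ
xorBits zero    m n = 0
xorBits (suc k) m n = (m + n) % 2 + xorBits k (m / 2) (n / 2) * 2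

-- Numbers up to k have at most k binary digits, so m + n bits suffice.
_xor_ : ℕ → ℕ → ℕ
m xor n = xorBits (m + n) m n

-- Extended to ℤ by two's complement, in which -[1+ n ] is the bitwise
-- negation of n, so that the shifted sum is defined for every shift.
_⊕_ : ℤ → ℤ → ℤ
(+ m)    ⊕ (+ n)    = + (m xor n)
(+ m)    ⊕ -[1+ n ] = -[1+ m xor n ]
-[1+ m ] ⊕ (+ n)    = -[1+ m xor n ]
-[1+ m ] ⊕ -[1+ n ] = + (m xor n)

_⊕[_]_ : ℤ → ℤ → ℤ → ℤ
x ⊕[ n ] y = ((x ℤ.+ n) ⊕ y) ℤ.- n

S₈ : Vec ℤ 24
S₈ = + 8 ∷ + 7 ∷ + 6 ∷ + 5 ∷ + 4 ∷ + 3 ∷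
     + 8 ∷ + 7 ∷ + 6 ∷ + 5 ∷ + 4 ∷ + 3 ∷
     + 4 ∷ + 3 ∷ + 2 ∷ + 1 ∷ + 0 ∷ -[1+ 0 ] ∷
     + 4 ∷ + 3 ∷ + 2 ∷ + 1 ∷ + 0 ∷ -[1+ 0 ] ∷ []

s₈ : ℕ → ℤ
s₈ j = Vec.lookup S₈ (j mod 24)

φ₈-table : Vec ℕ 64
φ₈-table =
   6 ∷  7 ∷  8 ∷  9 ∷ 10 ∷ 11 ∷  0 ∷  1 ∷  2 ∷  3 ∷
   4 ∷  5 ∷ 16 ∷ 17 ∷ 22 ∷ 23 ∷ 12 ∷ 13 ∷ 20 ∷ 21 ∷
  18 ∷ 19 ∷ 14 ∷ 15 ∷ 30 ∷ 31 ∷ 32 ∷ 33 ∷ 34 ∷ 35 ∷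
  24 ∷ 25 ∷ 26 ∷ 27 ∷ 28 ∷ 29 ∷ 40 ∷ 41 ∷ 44 ∷ 45 ∷
  36 ∷ 37 ∷ 48 ∷ 49 ∷ 38 ∷ 39 ∷ 52 ∷ 53 ∷ 42 ∷ 43 ∷
  56 ∷ 57 ∷ 46 ∷ 47 ∷ 60 ∷ 61 ∷ 50 ∷ 51 ∷ 62 ∷ 63 ∷
  54 ∷ 55 ∷ 58 ∷ 59 ∷ []

-- The integer inside ∣_∣ is nonnegative: see φ₈-shifted below.
φ₈ : ℕ → ℕ
φ₈ x with x <? 64
... | yes x<64 = Vec.lookup φ₈-table (fromℕ< x<64)
... | no  _    = ∣ (+ x) ⊕[ s₈ (x ∸ 64) ] (+ 6) ∣

private
  bit-≤ : ∀ a b → a < 2 → b < 2 → a ≤ (a + b) % 2 + b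
  bit-≤ 0 _ _ _ = z≤n
  bit-≤ 1 0 _ _ = s≤s z≤n
  bit-≤ 1 1 _ _ = s≤s z≤n
  bit-≤ 1 (suc (suc _)) _ (s≤s (s≤s ()))
  bit-≤ (suc (suc _)) _ (s≤s (s≤s ())) _

  half-≤ : ∀ m k → m ≤ suc k → m / 2 ≤ k
  half-≤ zero    k _   = z≤n
  half-≤ (suc m) k m≤k = s≤s⁻¹ (≤-trans (m/n<m (suc m) 2 (s≤s (s≤s z≤n))) m≤k)

  xorBits-≤ : ∀ k m n → m ≤ k → m ≤ xorBits k m n + n
  xorBits-≤ zero    m n m≤0 = ≤-trans m≤0 z≤n
  xorBits-≤ (suc k) m n m≤k = begin
    m                                      ≡⟨ m≡m%n+[m/n]*n m 2 ⟩
    m % 2 + m / 2 * 2                      ≤⟨ +-mono-≤ bits (*-monoˡ-≤ 2 ih) ⟩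
    ((m + n) % 2 + n % 2) + (r + n / 2) * 2
      ≡⟨ solve 4 (λ a b r d → (a :+ b) :+ (r :+ d) :* con 2 :=
                              (a :+ r :* con 2) :+ (b :+ d :* con 2))
               refl ((m + n) % 2) (n % 2) r (n / 2) ⟩
    ((m + n) % 2 + r * 2) + (n % 2 + n / 2 * 2)
      ≡⟨ cong (λ t → ((m + n) % 2 + r * 2) + t) (m≡m%n+[m/n]*n n 2) ⟨
    ((m + n) % 2 + r * 2) + n              ∎
    where
    open ≤-Reasoning
    open ℕ-Solver
    r = xorBits k (m / 2) (n / 2)
    ih = xorBits-≤ k (m / 2) (n / 2) (half-≤ m k m≤k)
    bits : m % 2 ≤ (m + n) % 2 + n % 2
    bits = subst (λ t → m % 2 ≤ t + n % 2) (sym (%-distribˡ-+ m n 2))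
                 (bit-≤ (m % 2) (n % 2) (m%n<n m 2) (m%n<n n 2))

  s₈≥-1 : ∀ j → -[1+ 0 ] ℤ.≤ s₈ j
  s₈≥-1 j = lookup⁺ (from-yes (All.all? (-[1+ 0 ] ℤ.≤?_) S₈)) (j mod 24)

  shifted-nonneg : ∀ x s → 64 ≤ x → -[1+ 0 ] ℤ.≤ s →
                   + 0 ℤ.≤ (+ x) ⊕[ s ] (+ 6)
  shifted-nonneg x s 64≤x -1≤s = aux (+ x ℤ.+ s) refl 0≤x+s
    where
    0≤x+s : + 0 ℤ.≤ + x ℤ.+ s
    0≤x+s = ℤ.+-mono-≤ {+ 1} {+ x} (ℤ.+≤+ (≤-trans (s≤s z≤n) 64≤x)) -1≤s
    aux : ∀ z → z ≡ + x ℤ.+ s → + 0 ℤ.≤ z → + 0 ℤ.≤ (z ⊕ (+ 6)) ℤ.- s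
    aux (+ m) m≡x+s _ = begin
      + 0                                    ≤⟨ ℤ.+-monoˡ-≤ (ℤ.- + 6) (ℤ.+≤+ (≤-trans (m≤m+n 6 58) 64≤x)) ⟩
      + x ℤ.- + 6                            ≡⟨ solve 2 (λ x s → x :- con (+ 6) := (x :+ s) :+ (:- s :- con (+ 6))) refl (+ x) s ⟩
      (+ x ℤ.+ s) ℤ.+ (ℤ.- s ℤ.- + 6)        ≡⟨ cong (ℤ._+ (ℤ.- s ℤ.- + 6)) m≡x+s ⟨
      + m ℤ.+ (ℤ.- s ℤ.- + 6)                ≤⟨ ℤ.+-monoˡ-≤ (ℤ.- s ℤ.- + 6) (ℤ.+≤+ (xorBits-≤ (m + 6) m 6 (m≤m+n m 6))) ⟩
      (+ (m xor 6) ℤ.+ + 6) ℤ.+ (ℤ.- s ℤ.- + 6)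
        ≡⟨ solve 2 (λ y s → (y :+ con (+ 6)) :+ (:- s :- con (+ 6)) := y :- s) refl (+ (m xor 6)) s ⟩
      + (m xor 6) ℤ.- s                      ∎
      where
      open ℤ.≤-Reasoning
      open +-*-Solver

φ₈-shifted : ∀ x → 64 ≤ x → + φ₈ x ≡ (+ x) ⊕[ s₈ (x ∸ 64) ] (+ 6)
φ₈-shifted x 64≤x with x <? 64
... | yes x<64 = contradiction x<64 (≤⇒≯ 64≤x)
... | no  _    = ℤ.0≤i⇒+∣i∣≡i (shifted-nonneg x (s₈ (x ∸ 64)) 64≤x (s₈≥-1 (x ∸ 64)))

{-# OPTIONS --safe #-}
module Submission where

-- For c ≤ 8 the 𝒫-positions a ∷ b ∷ c ∷ [] are given by an involution φ c, and
-- whether φ is right at a given a depends only on φ d a for d ≤ c, on φ c at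
-- the numbers between a and φ c a, and on φ ⌊c/2⌋ ⌊a/2⌋.  For large a these are
-- determined by a modulo 24 together with one bit τ a, and halving a flips τ,
-- so finitely many values of a have to be checked.

open import Defs
open import Data.List.Base using ([]; _∷_)
open import Data.Nat.Base using (ℕ)
open import Function.Bundles using (_⇔_)
open import Relation.Binary.PropositionalEquality using (_≡_)

open import Data.Bool.Base using (true; false; if_then_else_)
open import Data.Bool.Properties using (if-float)
import Data.Fin.Base as Fin
open import Data.Fin.Properties using (all?; fromℕ<-cong)
import Data.Integer.Base as ℤ
import Data.Integer.Properties as ℤ
open import Data.List.Base using (List; length)
open import Data.List.Relation.Unary.Any using (Any; here; there)
open import Data.Nat.Base hiding (ℕ)
open import Data.Nat.Divisibility using (divides)
open import Data.Nat.DivMod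
open import Data.Nat.Induction using (<-rec)
open import Data.Nat.Logarithm
open import Data.Nat.Properties
open import Data.Nat.Solver using (module +-*-Solver)
open import Data.Parity.Base using (Parity; 0ℙ; 1ℙ; _⁻¹)
open import Data.Parity.Properties using (suc-homo-⁻¹)
open import Data.Product.Base using (∃; _×_; _,_; proj₁; proj₂)
open import Data.Sum.Base using (_⊎_; inj₁; inj₂)
import Data.Sum.Base as Sum
import Data.Vec.Base as Vec
open import Function.Base using (id; _∘_)
open import Function.Bundles using (mk⇔)
open import Relation.Binary.Definitions using (tri<; tri≈; tri>)
open import Relation.Binary.PropositionalEquality
  using (_≢_; refl; sym; trans; cong; cong₂; subst; module ≡-Reasoning)
open import Relation.Nullary using (Dec; yes; no; ¬_; ¬?; contradiction)
open import Relation.Nullary.Decidable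
  using (from-yes; _×-dec_; _⊎-dec_; _→-dec_; decidable-stable)

-- Closed forms for the slices c ≤ 8

-- Cuts ℕ, from -o on, into blocks of length m and exchanges the first block
-- with the second, the third with the fourth, and so on.  The shifted sum
-- x ⊕[ o ] m is swap m o x when m is a power of two.
swap : (m o : ℕ) .{{_ : NonZero m}} → ℕ → ℕ
swap m o x = if (x + o) / m % 2 ≡ᵇ 0 then x + m else x ∸ m

-- Which of the intervals 28 · 2ᵏ ≤ x < 28 · 2ᵏ⁺¹ contains x, as the parity of k.
-- The slices c ≤ 3 never become periodic: they alternate with this parity.
τ : ℕ → Parity
τ x = parity ⌊log₂ (x / 28) ⌋

-- The values of φ c at large x, with τ x as second argument.
β : ℕ → Parity → ℕ → ℕ
β 0 0ℙ = swap 2 0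
β 0 1ℙ = id
β 1 p  = swap 1 0 ∘ β 0 p
β 2 p  = β 0 (p ⁻¹)
β 3 p  = swap 1 0 ∘ β 2 p
β 4 _  = swap 2 2
β 5 p  = swap 1 0 ∘ β 4 p
β 6 _  = swap 4 2
β 7 p  = swap 1 0 ∘ β 6 p
β _ _  = swap 6 8

initially : List ℕ → (ℕ → ℕ) → ℕ → ℕ
initially []       f x       = f x
initially (y ∷ ys) f zero    = y
initially (y ∷ ys) f (suc x) = initially ys (f ∘ suc) x

φ : ℕ → ℕ → ℕ
φ 0 = initially
  (  0 ∷  2 ∷  1 ∷  3 ∷  4 ∷  5 ∷  8 ∷  9 ∷  6 ∷  7 ∷
    12 ∷ 13 ∷ 10 ∷ 11 ∷ 14 ∷ 15 ∷ 16 ∷ 17 ∷ 18 ∷ 19 ∷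
    20 ∷ 21 ∷ 22 ∷ 23 ∷ 24 ∷ 25 ∷ 26 ∷ 27 ∷ [])
  (λ x → β 0 (τ x) x)
φ 1 = initially
  (  2 ∷  3 ∷  0 ∷  1 ∷  5 ∷  4 ∷  9 ∷  8 ∷  7 ∷  6 ∷
    13 ∷ 12 ∷ 11 ∷ 10 ∷ 15 ∷ 14 ∷ 17 ∷ 16 ∷ 19 ∷ 18 ∷
    21 ∷ 20 ∷ 23 ∷ 22 ∷ 25 ∷ 24 ∷ 27 ∷ 26 ∷ [])
  (λ x → β 1 (τ x) x)
φ 2 = initially
  (  1 ∷  0 ∷  2 ∷  4 ∷  3 ∷  6 ∷  5 ∷  7 ∷  8 ∷  9 ∷
    10 ∷ 11 ∷ 12 ∷ 13 ∷ 18 ∷ 19 ∷ 20 ∷ 21 ∷ 14 ∷ 15 ∷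
    16 ∷ 17 ∷ 26 ∷ 27 ∷ 28 ∷ 29 ∷ 22 ∷ 23 ∷ 24 ∷ 25 ∷ [])
  (λ x → β 2 (τ x) x)
φ 3 = initially
  (  3 ∷  1 ∷  4 ∷  0 ∷  2 ∷  7 ∷  6 ∷  5 ∷  9 ∷  8 ∷
    11 ∷ 10 ∷ 13 ∷ 12 ∷ 19 ∷ 18 ∷ 21 ∷ 20 ∷ 15 ∷ 14 ∷
    17 ∷ 16 ∷ 27 ∷ 26 ∷ 29 ∷ 28 ∷ 23 ∷ 22 ∷ 25 ∷ 24 ∷ [])
  (λ x → β 3 (τ x) x)
φ 4 = initially
  (  4 ∷  5 ∷  3 ∷  2 ∷  0 ∷  1 ∷  7 ∷  6 ∷ 10 ∷ 11 ∷
     8 ∷  9 ∷ 14 ∷ 15 ∷ 12 ∷ 13 ∷ 18 ∷ 19 ∷ 16 ∷ 17 ∷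
    22 ∷ 23 ∷ 20 ∷ 21 ∷ 26 ∷ 27 ∷ 24 ∷ 25 ∷ 28 ∷ 29 ∷ [])
  (λ x → β 4 (τ x) x)
φ 5 = initially
  (  5 ∷  4 ∷  6 ∷  7 ∷  1 ∷  0 ∷  2 ∷  3 ∷ 11 ∷ 10 ∷
     9 ∷  8 ∷ 15 ∷ 14 ∷ 13 ∷ 12 ∷ 19 ∷ 18 ∷ 17 ∷ 16 ∷
    23 ∷ 22 ∷ 21 ∷ 20 ∷ 27 ∷ 26 ∷ 25 ∷ 24 ∷ 29 ∷ 28 ∷ [])
  (λ x → β 5 (τ x) x)
φ 6 = initially
  (  8 ∷  9 ∷  5 ∷  6 ∷  7 ∷  2 ∷  3 ∷  4 ∷  0 ∷  1 ∷
    16 ∷ 17 ∷ 18 ∷ 19 ∷ 20 ∷ 21 ∷ 10 ∷ 11 ∷ 12 ∷ 13 ∷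
    14 ∷ 15 ∷ 24 ∷ 25 ∷ 22 ∷ 23 ∷ 28 ∷ 29 ∷ 26 ∷ 27 ∷ [])
  (λ x → β 6 (τ x) x)
φ 7 = initially
  (  9 ∷  8 ∷  7 ∷  5 ∷  6 ∷  3 ∷  4 ∷  2 ∷  1 ∷  0 ∷
    17 ∷ 16 ∷ 19 ∷ 18 ∷ 21 ∷ 20 ∷ 11 ∷ 10 ∷ 13 ∷ 12 ∷
    15 ∷ 14 ∷ 25 ∷ 24 ∷ 23 ∷ 22 ∷ 29 ∷ 28 ∷ 27 ∷ 26 ∷ [])
  (λ x → β 7 (τ x) x)
φ _ = φ₈

-- Local conditions and their finite verification

-- H stands for F at the halved argument, where the parity τ is reversed.  The
-- last component lists the winning moves from a ∷ b ∷ c ∷ [] with b = a + e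
-- below F c a; by symmetry of F the case b < a needs no separate check.
Local : (F H : ℕ → ℕ → ℕ) (c a : ℕ) → Set
Local F H c a =
    F c (F c a) ≡ a
  × (∀ {d} → d < c → F d a ≢ F c a)
  × (H ⌊ c /2⌋ ⌊ a /2⌋ ≡ ⌊ F c a /2⌋ → a ≡ 0 × c ≡ 0)
  × (∀ {e} → e < F c a ∸ a →
       F c (a + e) < a
     ⊎ (∃ λ d → d < c × F d a ≡ a + e)
     ⊎ H ⌊ c /2⌋ ⌊ a /2⌋ ≡ ⌊ a + e /2⌋)

local? : ∀ F H c a → Dec (Local F H c a)
local? F H c a =
        (F c (F c a) ≟ a)
  ×-dec allUpTo? (λ d → ¬? (F d a ≟ F c a)) c
  ×-dec ((H ⌊ c /2⌋ ⌊ a /2⌋ ≟ ⌊ F c a /2⌋) →-dec (a ≟ 0) ×-dec (c ≟ 0))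
  ×-dec allUpTo? (λ e → (F c (a + e) <? a)
                  ⊎-dec anyUpTo? (λ d → F d a ≟ a + e) c
                  ⊎-dec (H ⌊ c /2⌋ ⌊ a /2⌋ ≟ ⌊ a + e /2⌋))
                 (F c a ∸ a)

-- The last table, that of `φ₈`, ends at 64. The cutoff 88 lies one period of 24 beyond it, which
-- keeps the partners of all a ≥ 88 above 64.
local-small : ∀ {c} → c < 9 → ∀ {a} → a < 88 → Local φ φ c a
local-small = from-yes (allUpTo? (λ c → allUpTo? (local? φ φ c) 88) 9)

-- For c < 4, β c p depends on p, and the second component makes τ agree at a and
-- at all the arguments of β c.
Large : Parity → ℕ → ℕ → Set
Large p c a =
    64 ≤ β c p a
  × (c < 4 → β c p a / 4 ≡ a / 4)
  × Local (λ c → β c p) (λ c → β c (p ⁻¹)) c a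

large? : ∀ p c a → Dec (Large p c a)
large? p c a =
        (64 ≤? β c p a)
  ×-dec ((c <? 4) →-dec (β c p a / 4 ≟ a / 4))
  ×-dec local? (λ c → β c p) (λ c → β c (p ⁻¹)) c a

-- `τ` is not periodic modulo 24, so both parities are checked in every residue class; the induction
-- then keeps p fixed and need not follow `τ` from a to 24 + a.
large-base : ∀ p {c} → c < 9 → ∀ {k} → k < 24 → Large p c (88 + k)
large-base 0ℙ = from-yes (allUpTo? (λ c → allUpTo? (λ k → large? 0ℙ c (88 + k)) 24) 9)
large-base 1ℙ = from-yes (allUpTo? (λ c → allUpTo? (λ k → large? 1ℙ c (88 + k)) 24) 9)

-- Translation by the period 24

/-shift : ∀ q n d .{{_ : NonZero d}} → (q * d + n) / d ≡ q + n / d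
/-shift q n d = trans (+-distrib-/-∣ˡ n (divides q refl)) (cong (_+ n / d) (m*n/n≡m q d))

24-induction : (P : ℕ → Set) (n : ℕ) → (∀ {k} → k < 24 → P (n + k)) →
               (∀ a → n ≤ a → P a → P (24 + a)) → ∀ a → n ≤ a → P a
24-induction P n base step = <-rec _ go
  where
  go : ∀ a → (∀ {a′} → a′ < a → n ≤ a′ → P a′) → n ≤ a → P a
  go a rec n≤a with a ∸ n <? 24
  ... | yes k<24 = subst P (m+[n∸m]≡n n≤a) (base k<24)
  ... | no  k≮24 = subst P 24+a′≡a (step a′ n≤a′ (rec a′<a n≤a′))
    where
    n+24≤a : n + 24 ≤ a
    n+24≤a = subst (n + 24 ≤_) (m+[n∸m]≡n n≤a) (+-monoʳ-≤ n (≮⇒≥ k≮24))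
    a′ = a ∸ 24
    24+a′≡a : 24 + a′ ≡ a
    24+a′≡a = m+[n∸m]≡n (≤-trans (m≤n+m 24 n) n+24≤a)
    n≤a′ : n ≤ a′
    n≤a′ = m+n≤o⇒m≤o∸n n n+24≤a
    a′<a : a′ < a
    a′<a = subst (a′ <_) 24+a′≡a (m<n+m a′ z<s)

-- Written with j * 2 * m so that the multiple of the period 2 m computes to 12
-- or 24 in applications.
swap-shift : ∀ m o j .{{_ : NonZero m}} {x} → m ≤ x →
             swap m o (j * 2 * m + x) ≡ j * 2 * m + swap m o x
swap-shift m o j {x} m≤x = begin
  swap m o (j * 2 * m + x)
    ≡⟨ cong (λ r → if r ≡ᵇ 0 then j * 2 * m + x + m else j * 2 * m + x ∸ m) same-block ⟩
  (if (x + o) / m % 2 ≡ᵇ 0 then j * 2 * m + x + m else j * 2 * m + x ∸ m)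
    ≡⟨ cong₂ (λ y z → if (x + o) / m % 2 ≡ᵇ 0 then y else z)
             (+-assoc (j * 2 * m) x m) (+-∸-assoc (j * 2 * m) m≤x) ⟩
  (if (x + o) / m % 2 ≡ᵇ 0 then j * 2 * m + (x + m) else j * 2 * m + (x ∸ m))
    ≡⟨ if-float (j * 2 * m +_) ((x + o) / m % 2 ≡ᵇ 0) ⟨
  j * 2 * m + swap m o x ∎
  where
  open ≡-Reasoning
  same-block : (j * 2 * m + x + o) / m % 2 ≡ (x + o) / m % 2
  same-block = begin
    (j * 2 * m + x + o) / m % 2        ≡⟨ cong (λ y → y / m % 2) (+-assoc (j * 2 * m) x o) ⟩
    (j * 2 * m + (x + o)) / m % 2      ≡⟨ cong (_% 2) (/-shift (j * 2) (x + o) m) ⟩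
    (j * 2 + (x + o) / m) % 2          ≡⟨ cong (_% 2) (+-comm (j * 2) ((x + o) / m)) ⟩
    ((x + o) / m + j * 2) % 2          ≡⟨ [m+kn]%n≡m%n ((x + o) / m) j 2 ⟩
    (x + o) / m % 2                    ∎

swap-positive : ∀ m o .{{_ : NonZero m}} {x} → m < x → 0 < swap m o x
swap-positive m o {x} m<x with (x + o) / m % 2 ≡ᵇ 0
... | true  = ≤-trans (≤-<-trans z≤n m<x) (m≤m+n x m)
... | false = m<n⇒0<n∸m m<x

-- The equation writes one shift as a multiple of both periods, 2 and 2 m. Since m < x, the inner
-- value is positive and the outer subtraction does not truncate.
swap-1-swap-shift : ∀ i j m o .{{_ : NonZero m}} {x} → i * 2 * 1 ≡ j * 2 * m → m < x →
  swap 1 0 (swap m o (j * 2 * m + x)) ≡ j * 2 * m + swap 1 0 (swap m o x)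
swap-1-swap-shift i j m o {x} p m<x = begin
  swap 1 0 (swap m o (j * 2 * m + x))  ≡⟨ cong (swap 1 0) (swap-shift m o j (<⇒≤ m<x)) ⟩
  swap 1 0 (j * 2 * m + swap m o x)    ≡⟨ cong (λ k → swap 1 0 (k + swap m o x)) p ⟨
  swap 1 0 (i * 2 * 1 + swap m o x)    ≡⟨ swap-shift 1 0 i (swap-positive m o m<x) ⟩
  i * 2 * 1 + swap 1 0 (swap m o x)    ≡⟨ cong (_+ swap 1 0 (swap m o x)) p ⟩
  j * 2 * m + swap 1 0 (swap m o x)    ∎
  where open ≡-Reasoning

-- At a halved argument the slice index is at most 4, and a shift by 24 becomes a shift by 12. The
-- swaps in these slices have period 2 or 4, both divisors of 12.
β-shift-12 : ∀ {c} → c < 5 → ∀ p {x} → 30 ≤ x → β c p (12 + x) ≡ 12 + β c p x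
β-shift-12 {0} _ 0ℙ x≥ = swap-shift 2 0 3 (≤-trans (m≤m+n 2 28) x≥)
β-shift-12 {0} _ 1ℙ x≥ = refl
β-shift-12 {1} _ 0ℙ x≥ = swap-1-swap-shift 6 3 2 0 refl (≤-trans (m≤m+n 3 27) x≥)
β-shift-12 {1} _ 1ℙ x≥ = swap-shift 1 0 6 (≤-trans (m≤m+n 1 29) x≥)
β-shift-12 {2} _ 0ℙ x≥ = refl
β-shift-12 {2} _ 1ℙ x≥ = swap-shift 2 0 3 (≤-trans (m≤m+n 2 28) x≥)
β-shift-12 {3} _ 0ℙ x≥ = swap-shift 1 0 6 (≤-trans (m≤m+n 1 29) x≥)
β-shift-12 {3} _ 1ℙ x≥ = swap-1-swap-shift 6 3 2 0 refl (≤-trans (m≤m+n 3 27) x≥)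
β-shift-12 {4} _ _  x≥ = swap-shift 2 2 3 (≤-trans (m≤m+n 2 28) x≥)
β-shift-12 {suc (suc (suc (suc (suc _))))} (s≤s (s≤s (s≤s (s≤s (s≤s ())))))

-- 24 is the least common multiple of the periods 4, 8 and 12 of the swaps with m = 2, 4 and 6.
β-shift-24 : ∀ c p {x} → 30 ≤ x → β c p (24 + x) ≡ 24 + β c p x
β-shift-24 c p {x} x≥ with c <? 5
... | yes c<5 = trans (β-shift-12 c<5 p (≤-trans x≥ (m≤n+m x 12)))
                      (cong (12 +_) (β-shift-12 c<5 p x≥))
... | no  c≮5 with m≤n⇒∃[o]m+o≡n (≮⇒≥ c≮5)
... | 0 , refl = swap-1-swap-shift 12 6 2 2 refl (≤-trans (m≤m+n 3 27) x≥)
... | 1 , refl = swap-shift 4 2 3 (≤-trans (m≤m+n 4 26) x≥)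
... | 2 , refl = swap-1-swap-shift 12 3 4 2 refl (≤-trans (m≤m+n 5 25) x≥)
... | suc (suc (suc _)) , refl = swap-shift 6 8 2 (≤-trans (m≤m+n 6 24) x≥)

⌊c/2⌋<5 : ∀ {c} → c < 9 → ⌊ c /2⌋ < 5
⌊c/2⌋<5 c<9 = s≤s (⌊n/2⌋-mono (s≤s⁻¹ c<9))

large-step : ∀ p {c a} → c < 9 → 64 ≤ a → Large p c a → Large p c (24 + a)
large-step p {c} {a} c<9 64≤a (64≤b , same , inv , dist , half , reach) =
  64≤b′ , same′ , inv′ , dist′ , half′ , reach′
  where
  open ≡-Reasoning
  b = β c p a
  h = β ⌊ c /2⌋ (p ⁻¹) ⌊ a /2⌋
  30≤a : 30 ≤ a
  30≤a = ≤-trans (m≤m+n 30 34) 64≤a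
  b-shift : ∀ d → β d p (24 + a) ≡ 24 + β d p a
  b-shift d = β-shift-24 d p 30≤a
  h-shift : β ⌊ c /2⌋ (p ⁻¹) ⌊ 24 + a /2⌋ ≡ 12 + h
  h-shift = β-shift-12 (⌊c/2⌋<5 c<9) (p ⁻¹) (≤-trans (m≤m+n 30 2) (⌊n/2⌋-mono 64≤a))
  quarter : ∀ x → (24 + x) / 4 ≡ 6 + x / 4
  quarter x = /-shift 6 x 4

  64≤b′ : 64 ≤ β c p (24 + a)
  64≤b′ = subst (64 ≤_) (sym (b-shift c)) (≤-trans 64≤b (m≤n+m b 24))

  same′ : c < 4 → β c p (24 + a) / 4 ≡ (24 + a) / 4
  same′ c<4 = begin
    β c p (24 + a) / 4  ≡⟨ cong (_/ 4) (b-shift c) ⟩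
    (24 + b) / 4        ≡⟨ quarter b ⟩
    6 + b / 4           ≡⟨ cong (6 +_) (same c<4) ⟩
    6 + a / 4           ≡⟨ quarter a ⟨
    (24 + a) / 4        ∎

  inv′ : β c p (β c p (24 + a)) ≡ 24 + a
  inv′ = begin
    β c p (β c p (24 + a))  ≡⟨ cong (β c p) (b-shift c) ⟩
    β c p (24 + b)          ≡⟨ β-shift-24 c p (≤-trans (m≤m+n 30 34) 64≤b) ⟩
    24 + β c p b            ≡⟨ cong (24 +_) inv ⟩
    24 + a                  ∎

  dist′ : ∀ {d} → d < c → β d p (24 + a) ≢ β c p (24 + a)
  dist′ {d} d<c eq = dist d<c
    (+-cancelˡ-≡ 24 _ _ (trans (sym (b-shift d)) (trans eq (b-shift c))))

  half′ : β ⌊ c /2⌋ (p ⁻¹) ⌊ 24 + a /2⌋ ≡ ⌊ β c p (24 + a) /2⌋ → 24 + a ≡ 0 × c ≡ 0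
  -- The exceptional conclusion of `half` is impossible for a ≥ 64, so the clause at a says that the
  -- halved values differ.
  half′ eq = contradiction (proj₁ (half half-eq)) (>⇒≢ (≤-trans (m≤m+n 1 63) 64≤a))
    where
    half-eq : h ≡ ⌊ b /2⌋
    half-eq = +-cancelˡ-≡ 12 _ _ (begin
      12 + h                         ≡⟨ h-shift ⟨
      β ⌊ c /2⌋ (p ⁻¹) ⌊ 24 + a /2⌋  ≡⟨ eq ⟩
      ⌊ β c p (24 + a) /2⌋           ≡⟨ cong ⌊_/2⌋ (b-shift c) ⟩
      12 + ⌊ b /2⌋                   ∎)

  reach′ : ∀ {e} → e < β c p (24 + a) ∸ (24 + a) →
       β c p (24 + a + e) < 24 + a
     ⊎ (∃ λ d → d < c × β d p (24 + a) ≡ 24 + a + e)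
     ⊎ β ⌊ c /2⌋ (p ⁻¹) ⌊ 24 + a /2⌋ ≡ ⌊ 24 + a + e /2⌋
  reach′ {e} e< with reach (subst (λ x → e < x ∸ (24 + a)) (b-shift c) e<)
  ... | inj₁ <a =
    inj₁ (subst (_< 24 + a) (sym (β-shift-24 c p (≤-trans 30≤a (m≤m+n a e)))) (+-monoʳ-< 24 <a))
  ... | inj₂ (inj₁ (d , d<c , eq)) = inj₂ (inj₁ (d , d<c , trans (b-shift d) (cong (24 +_) eq)))
  ... | inj₂ (inj₂ eq) = inj₂ (inj₂ (trans h-shift (cong (12 +_) eq)))

large : ∀ p {c} → c < 9 → ∀ a → 88 ≤ a → Large p c a
large p {c} c<9 = 24-induction (Large p c) 88 (large-base p c<9) λ a 88≤a →
  large-step p c<9 (≤-trans (m≤m+n 64 24) 88≤a)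

-- The parity τ under halving and within blocks of four

n/2≡⌊n/2⌋ : ∀ n → n / 2 ≡ ⌊ n /2⌋
n/2≡⌊n/2⌋ 0             = refl
n/2≡⌊n/2⌋ 1             = refl
n/2≡⌊n/2⌋ (suc (suc n)) = trans (/-shift 1 n 2) (cong suc (n/2≡⌊n/2⌋ n))

parity-∸1 : ∀ {n} → 1 ≤ n → parity (n ∸ 1) ≡ parity n ⁻¹
parity-∸1 {suc n} _ = sym (suc-homo-⁻¹ n)

-- Halving lowers the logarithm by one. From 56 on, x / 28 is at least 2, so its logarithm is
-- positive and the truncated `∸ 1` does flip the parity.
τ-half : ∀ {x} → 56 ≤ x → τ ⌊ x /2⌋ ≡ τ x ⁻¹
τ-half {x} 56≤x = begin
  parity ⌊log₂ (⌊ x /2⌋ / 28) ⌋    ≡⟨ cong (λ y → parity ⌊log₂ y ⌋) half ⟩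
  parity ⌊log₂ ⌊ x / 28 /2⌋ ⌋      ≡⟨ cong parity (⌊log₂⌊n/2⌋⌋≡⌊log₂n⌋∸1 (x / 28)) ⟩
  parity (⌊log₂ (x / 28) ⌋ ∸ 1)    ≡⟨ parity-∸1 (⌊log₂⌋-mono-≤ (/-monoˡ-≤ 28 56≤x)) ⟩
  parity ⌊log₂ (x / 28) ⌋ ⁻¹       ∎
  where
  open ≡-Reasoning
  half : ⌊ x /2⌋ / 28 ≡ ⌊ x / 28 /2⌋
  half = begin
    ⌊ x /2⌋ / 28    ≡⟨ cong (_/ 28) (n/2≡⌊n/2⌋ x) ⟨
    x / 2 / 28      ≡⟨ m/n/o≡m/[n*o] x 2 28 ⟩
    x / 56          ≡⟨ m/n/o≡m/[n*o] x 28 2 ⟨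
    x / 28 / 2      ≡⟨ n/2≡⌊n/2⌋ (x / 28) ⟩
    ⌊ x / 28 /2⌋    ∎

-- 28 is a multiple of 4, so `τ` never changes inside a block of four.
τ-cong : ∀ x y → x / 4 ≡ y / 4 → τ x ≡ τ y
τ-cong x y eq = cong (λ z → parity ⌊log₂ z ⌋) (begin
  x / 28     ≡⟨ m/n/o≡m/[n*o] x 4 7 ⟨
  x / 4 / 7  ≡⟨ cong (_/ 7) eq ⟩
  y / 4 / 7  ≡⟨ m/n/o≡m/[n*o] y 4 7 ⟩
  y / 28     ∎)
  where open ≡-Reasoning

β-parity-irrelevant : ∀ k p q x → β (4 + k) p x ≡ β (4 + k) q x
β-parity-irrelevant 0                         p q x = refl
β-parity-irrelevant 1                         p q x = refl
β-parity-irrelevant 2                         p q x = refl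
β-parity-irrelevant 3                         p q x = refl
β-parity-irrelevant (suc (suc (suc (suc _)))) p q x = refl

β-τ-cong : ∀ c x y → (c < 4 → x / 4 ≡ y / 4) → β c (τ x) x ≡ β c (τ y) x
β-τ-cong c x y eq with c <? 4
... | yes c<4 = cong (λ p → β c p x) (τ-cong x y (eq c<4))
... | no  c≮4 with k , refl ← m≤n⇒∃[o]m+o≡n (≮⇒≥ c≮4) = β-parity-irrelevant k (τ x) (τ y) x

-- Shifted XOR with 6 as an exchange of blocks

xorBits-0 : ∀ k {m} → m ≤ k → xorBits k m 0 ≡ m
xorBits-0 zero    z≤n = refl
xorBits-0 (suc k) {m} m≤ = begin
  (m + 0) % 2 + xorBits k (m / 2) 0 * 2  ≡⟨ cong (λ x → x % 2 + xorBits k (m / 2) 0 * 2) (+-identityʳ m) ⟩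
  m % 2 + xorBits k (m / 2) 0 * 2        ≡⟨ cong (λ x → m % 2 + x * 2) (xorBits-0 k (half≤ m m≤)) ⟩
  m % 2 + m / 2 * 2                      ≡⟨ m≡m%n+[m/n]*n m 2 ⟨
  m                                      ∎
  where
  open ≡-Reasoning
  half≤ : ∀ m → m ≤ suc k → m / 2 ≤ k
  half≤ zero    _  = z≤n
  half≤ (suc m) m≤ = s≤s⁻¹ (≤-trans (m/n<m (suc m) 2 (s≤s (s≤s z≤n))) m≤)

-- 6 has three binary digits: after three unfoldings the second argument is 0 and `xorBits-0`
-- applies.
xor-6 : ∀ m → m xor 6 ≡
        (m + 6) % 2 + ((m / 2 + 3) % 2 + ((m / 2 / 2 + 1) % 2 + m / 2 / 2 / 2 * 2) * 2) * 2
xor-6 m = begin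
  xorBits (m + 6) m 6  ≡⟨ cong (λ k → xorBits k m 6) (+-comm m 6) ⟩
  xorBits (6 + m) m 6
    ≡⟨ cong (λ r → (m + 6) % 2 + ((m / 2 + 3) % 2 + ((m / 2 / 2 + 1) % 2 + r * 2) * 2) * 2)
            (xorBits-0 (3 + m) (≤-trans (m/n≤m (m / 2 / 2) 2) (≤-trans (m/n≤m (m / 2) 2)
              (≤-trans (m/n≤m m 2) (m≤n+m m 3))))) ⟩
  (m + 6) % 2 + ((m / 2 + 3) % 2 + ((m / 2 / 2 + 1) % 2 + m / 2 / 2 / 2 * 2) * 2) * 2 ∎
  where open ≡-Reasoning

-- 8 is the first power of two above the digits of 6, so adding it affects only the part of m that
-- the XOR leaves alone.
xor-6-shift : ∀ m → (8 + m) xor 6 ≡ 8 + m xor 6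
xor-6-shift m = begin
  (8 + m) xor 6
    ≡⟨ xor-6 (8 + m) ⟩
  (m + 6) % 2 + (((8 + m) / 2 + 3) % 2 + (((8 + m) / 2 / 2 + 1) % 2 + (8 + m) / 2 / 2 / 2 * 2) * 2) * 2
    ≡⟨ cong (λ x → (m + 6) % 2 + ((x + 3) % 2 + ((x / 2 + 1) % 2 + x / 2 / 2 * 2) * 2) * 2)
            (/-shift 4 m 2) ⟩
  (m + 6) % 2 + ((m / 2 + 3) % 2 + (((4 + m / 2) / 2 + 1) % 2 + (4 + m / 2) / 2 / 2 * 2) * 2) * 2
    ≡⟨ cong (λ x → (m + 6) % 2 + ((m / 2 + 3) % 2 + ((x + 1) % 2 + x / 2 * 2) * 2) * 2)
            (/-shift 2 (m / 2) 2) ⟩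
  (m + 6) % 2 + ((m / 2 + 3) % 2 + ((m / 2 / 2 + 1) % 2 + (2 + m / 2 / 2) / 2 * 2) * 2) * 2
    ≡⟨ cong (λ x → (m + 6) % 2 + ((m / 2 + 3) % 2 + ((m / 2 / 2 + 1) % 2 + x * 2) * 2) * 2)
            (/-shift 1 (m / 2 / 2) 2) ⟩
  (m + 6) % 2 + ((m / 2 + 3) % 2 + ((m / 2 / 2 + 1) % 2 + (1 + m / 2 / 2 / 2) * 2) * 2) * 2
    ≡⟨ solve 4 (λ x y z w → x :+ (y :+ (z :+ (con 1 :+ w) :* con 2) :* con 2) :* con 2
                         := con 8 :+ (x :+ (y :+ (z :+ w :* con 2) :* con 2) :* con 2))
         refl ((m + 6) % 2) ((m / 2 + 3) % 2) ((m / 2 / 2 + 1) % 2) (m / 2 / 2 / 2) ⟩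
  8 + ((m + 6) % 2 + ((m / 2 + 3) % 2 + ((m / 2 / 2 + 1) % 2 + m / 2 / 2 / 2 * 2) * 2) * 2)
    ≡⟨ cong (8 +_) (xor-6 m) ⟨
  8 + m xor 6 ∎
  where
  open ≡-Reasoning
  open +-*-Solver

s₈-periodic : ∀ j → s₈ (24 + j) ≡ s₈ j
s₈-periodic j = cong (Vec.lookup S₈)
  (fromℕ<-cong _ _ (trans (cong (_% 24) (+-comm 24 j)) ([m+n]%n≡m%n j 24)) _ _)

-- The entries of `S₈` are at least -1, so x + s is a natural number for x ≥ 1, and `⊕` is computed
-- by its clause for two natural numbers.
1+s₈≥0 : ∀ j → ∃ λ m → ℤ.+ 1 ℤ.+ s₈ j ≡ ℤ.+ m
1+s₈≥0 j = _ , sym (ℤ.0≤i⇒+∣i∣≡i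
  (from-yes (all? (λ i → ℤ.+ 0 ℤ.≤? ℤ.+ 1 ℤ.+ Vec.lookup S₈ i)) (j mod 24)))

⊕-6-shift : ∀ m → (ℤ.+ (24 + m)) ⊕ (ℤ.+ 6) ≡ ℤ.+ 24 ℤ.+ ((ℤ.+ m) ⊕ (ℤ.+ 6))
⊕-6-shift m = cong ℤ.+_ (begin
  (24 + m) xor 6         ≡⟨ xor-6-shift (16 + m) ⟩
  8 + (16 + m) xor 6     ≡⟨ cong (8 +_) (xor-6-shift (8 + m)) ⟩
  16 + (8 + m) xor 6     ≡⟨ cong (16 +_) (xor-6-shift m) ⟩
  24 + m xor 6           ∎)
  where open ≡-Reasoning

⊕[]-6-shift : ∀ x s {m} → ℤ.+ x ℤ.+ s ≡ ℤ.+ m →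
              (ℤ.+ (24 + x)) ⊕[ s ] (ℤ.+ 6) ≡ ℤ.+ 24 ℤ.+ (ℤ.+ x) ⊕[ s ] (ℤ.+ 6)
⊕[]-6-shift x s {m} x+s≡m = begin
  ((ℤ.+ (24 + x) ℤ.+ s) ⊕ (ℤ.+ 6)) ℤ.- s
    ≡⟨ cong (λ z → (z ⊕ (ℤ.+ 6)) ℤ.- s)
            (trans (ℤ.+-assoc (ℤ.+ 24) (ℤ.+ x) s) (cong (ℤ._+_ (ℤ.+ 24)) x+s≡m)) ⟩
  ((ℤ.+ (24 + m)) ⊕ (ℤ.+ 6)) ℤ.- s
    ≡⟨ cong (ℤ._- s) (⊕-6-shift m) ⟩
  (ℤ.+ 24 ℤ.+ ((ℤ.+ m) ⊕ (ℤ.+ 6))) ℤ.- s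
    ≡⟨ ℤ.+-assoc (ℤ.+ 24) ((ℤ.+ m) ⊕ (ℤ.+ 6)) (ℤ.- s) ⟩
  ℤ.+ 24 ℤ.+ (((ℤ.+ m) ⊕ (ℤ.+ 6)) ℤ.- s)
    ≡⟨ cong (λ z → ℤ.+ 24 ℤ.+ ((z ⊕ (ℤ.+ 6)) ℤ.- s)) x+s≡m ⟨
  ℤ.+ 24 ℤ.+ (ℤ.+ x) ⊕[ s ] (ℤ.+ 6) ∎
  where open ≡-Reasoning

-- 24 is both the length of `S₈` and a multiple of 8, so the shifts and the bits touched by the XOR
-- repeat together.
φ₈-shift : ∀ {x} → 64 ≤ x → φ₈ (24 + x) ≡ 24 + φ₈ x
φ₈-shift {x@(suc w)} 64≤x = ℤ.+-injective (begin
  ℤ.+ φ₈ (24 + x)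
    ≡⟨ φ₈-shifted (24 + x) (≤-trans 64≤x (m≤n+m x 24)) ⟩
  (ℤ.+ (24 + x)) ⊕[ s₈ (24 + x ∸ 64) ] (ℤ.+ 6)
    ≡⟨ cong (λ t → (ℤ.+ (24 + x)) ⊕[ t ] (ℤ.+ 6))
            (trans (cong s₈ (+-∸-assoc 24 64≤x)) (s₈-periodic (x ∸ 64))) ⟩
  (ℤ.+ (24 + x)) ⊕[ s ] (ℤ.+ 6)
    ≡⟨ ⊕[]-6-shift x s x+s≡ ⟩
  ℤ.+ 24 ℤ.+ (ℤ.+ x) ⊕[ s ] (ℤ.+ 6)
    ≡⟨ cong (ℤ._+_ (ℤ.+ 24)) (φ₈-shifted x 64≤x) ⟨
  ℤ.+ (24 + φ₈ x) ∎)
  where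
  open ≡-Reasoning
  s = s₈ (x ∸ 64)
  m = proj₁ (1+s₈≥0 (x ∸ 64))
  x+s≡ : ℤ.+ x ℤ.+ s ≡ ℤ.+ (w + m)
  x+s≡ = begin
    ℤ.+ x ℤ.+ s              ≡⟨ cong (λ k → ℤ.+ k ℤ.+ s) (+-comm w 1) ⟨
    ℤ.+ w ℤ.+ ℤ.+ 1 ℤ.+ s    ≡⟨ ℤ.+-assoc (ℤ.+ w) (ℤ.+ 1) s ⟩
    ℤ.+ w ℤ.+ (ℤ.+ 1 ℤ.+ s)  ≡⟨ cong (ℤ._+_ (ℤ.+ w)) (proj₂ (1+s₈≥0 (x ∸ 64))) ⟩
    ℤ.+ (w + m)              ∎

φ₈-swap-base : ∀ {k} → k < 24 → φ₈ (64 + k) ≡ swap 6 8 (64 + k)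
φ₈-swap-base = from-yes (allUpTo? (λ k → φ₈ (64 + k) ≟ swap 6 8 (64 + k)) 24)

-- Under the shifts S₈, XOR with 6 exchanges adjacent blocks of length 6.
φ₈≡swap : ∀ x → 64 ≤ x → φ₈ x ≡ swap 6 8 x
φ₈≡swap = 24-induction (λ x → φ₈ x ≡ swap 6 8 x) 64 φ₈-swap-base λ x 64≤x eq →
  trans (φ₈-shift 64≤x) (trans (cong (24 +_) eq)
    (sym (swap-shift 6 8 2 (≤-trans (m≤m+n 6 58) 64≤x))))

-- Transfer from β to φ

initially-beyond : ∀ ys f {x} → length ys ≤ x → initially ys f x ≡ f x
initially-beyond []       f _         = refl
initially-beyond (y ∷ ys) f (s≤s len) = initially-beyond ys (f ∘ suc) len

φ≡β-low : ∀ {c} → c < 8 → ∀ {x} → 30 ≤ x → φ c x ≡ β c (τ x) x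
φ≡β-low {0} _ x≥ = initially-beyond (_ ∷ _) _ (≤-trans (m≤m+n 28 2) x≥)
φ≡β-low {1} _ x≥ = initially-beyond (_ ∷ _) _ (≤-trans (m≤m+n 28 2) x≥)
φ≡β-low {2} _ x≥ = initially-beyond (_ ∷ _) _ x≥
φ≡β-low {3} _ x≥ = initially-beyond (_ ∷ _) _ x≥
φ≡β-low {4} _ x≥ = initially-beyond (_ ∷ _) _ x≥
φ≡β-low {5} _ x≥ = initially-beyond (_ ∷ _) _ x≥
φ≡β-low {6} _ x≥ = initially-beyond (_ ∷ _) _ x≥
φ≡β-low {7} _ x≥ = initially-beyond (_ ∷ _) _ x≥
φ≡β-low {suc (suc (suc (suc (suc (suc (suc (suc _)))))))}
  (s≤s (s≤s (s≤s (s≤s (s≤s (s≤s (s≤s (s≤s ()))))))))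

φ≡β : ∀ c {x} → 64 ≤ x → φ c x ≡ β c (τ x) x
φ≡β c {x} x≥ with c <? 8
... | yes c<8 = φ≡β-low c<8 (≤-trans (m≤m+n 30 34) x≥)
... | no  c≮8 with _ , refl ← m≤n⇒∃[o]m+o≡n (≮⇒≥ c≮8) = φ₈≡swap x x≥

/4-squeeze : ∀ a b e → e < b ∸ a → b / 4 ≡ a / 4 → (a + e) / 4 ≡ a / 4
/4-squeeze a b e e<b∸a b/4≡a/4 = ≤-antisym
  (≤-trans (/-monoˡ-≤ 4 a+e≤b) (≤-reflexive b/4≡a/4))
  (/-monoˡ-≤ 4 (m≤m+n a e))
  where
  a≤b : a ≤ b
  a≤b = <⇒≤ (m∸n≢0⇒n<m (λ b∸a≡0 → contradiction (subst (e <_) b∸a≡0 e<b∸a) λ ()))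
  a+e≤b : a + e ≤ b
  a+e≤b = subst (a + e ≤_) (m+[n∸m]≡n a≤b) (+-monoʳ-≤ a (<⇒≤ e<b∸a))

-- `φ` evaluates `τ` at each of its arguments, whereas `large` fixes the parity `τ a`. They agree:
-- for c < 4 the arguments of slice c that occur lie in the block of four of a, and for c ≥ 4 the
-- values of `β c` are the same for both parities.
local-large : ∀ {c} → c < 9 → ∀ {a} → 88 ≤ a → Local φ φ c a
local-large {c} c<9 {a} 88≤a with large (τ a) c<9 a 88≤a
... | 64≤b , same , inv , dist , half , reach = inv′ , dist′ , half′ , reach′
  where
  open ≡-Reasoning
  b = β c (τ a) a
  64≤a : 64 ≤ a
  64≤a = ≤-trans (m≤m+n 64 24) 88≤a
  φ-a : ∀ d → φ d a ≡ β d (τ a) a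
  φ-a d = φ≡β d 64≤a
  φ-near : ∀ {x} → 64 ≤ x → (c < 4 → x / 4 ≡ a / 4) → φ c x ≡ β c (τ a) x
  φ-near 64≤x near = trans (φ≡β c 64≤x) (β-τ-cong c _ a near)
  φ-half : φ ⌊ c /2⌋ ⌊ a /2⌋ ≡ β ⌊ c /2⌋ (τ a ⁻¹) ⌊ a /2⌋
  φ-half = begin
    φ ⌊ c /2⌋ ⌊ a /2⌋
      ≡⟨ φ≡β-low (≤-trans (⌊c/2⌋<5 c<9) (m≤m+n 5 3)) (≤-trans (m≤m+n 30 2) (⌊n/2⌋-mono 64≤a)) ⟩
    β ⌊ c /2⌋ (τ ⌊ a /2⌋) ⌊ a /2⌋
      ≡⟨ cong (λ p → β ⌊ c /2⌋ p ⌊ a /2⌋) (τ-half (≤-trans (m≤m+n 56 8) 64≤a)) ⟩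
    β ⌊ c /2⌋ (τ a ⁻¹) ⌊ a /2⌋ ∎

  inv′ : φ c (φ c a) ≡ a
  -- `64≤b` puts the partner b beyond the tables; for c < 4, `same` gives it the parity of a.
  inv′ = trans (cong (φ c) (φ-a c)) (trans (φ-near 64≤b same) inv)

  dist′ : ∀ {d} → d < c → φ d a ≢ φ c a
  dist′ {d} d<c eq = dist d<c (trans (sym (φ-a d)) (trans eq (φ-a c)))

  half′ : φ ⌊ c /2⌋ ⌊ a /2⌋ ≡ ⌊ φ c a /2⌋ → a ≡ 0 × c ≡ 0
  half′ eq = half (trans (sym φ-half) (trans eq (cong ⌊_/2⌋ (φ-a c))))

  reach′ : ∀ {e} → e < φ c a ∸ a →
       φ c (a + e) < a
     ⊎ (∃ λ d → d < c × φ d a ≡ a + e)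
     ⊎ φ ⌊ c /2⌋ ⌊ a /2⌋ ≡ ⌊ a + e /2⌋
  reach′ {e} e<′ = Sum.map
    -- a + e lies between a and its partner, hence for c < 4 in the same block of four.
    (subst (_< a) (sym (φ-near (≤-trans 64≤a (m≤m+n a e)) (/4-squeeze a b e e< ∘ same))))
    (Sum.map (λ (d , d<c , eq) → d , d<c , trans (φ-a d) eq) (trans φ-half))
    (reach e<)
    where
    e< : e < b ∸ a
    e< = subst (λ x → e < x ∸ a) (φ-a c) e<′

local : ∀ {c} → c < 9 → ∀ a → Local φ φ c a
local c<9 a with a <? 88
... | yes a<88 = local-small c<9 a<88
... | no  a≮88 = local-large c<9 (≮⇒≥ a≮88)

-- Winning moves off the graph of φ

φ-involutive : ∀ {c} → c < 9 → ∀ a → φ c (φ c a) ≡ a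
φ-involutive c<9 a = proj₁ (local c<9 a)

φ-transpose : ∀ {c} → c < 9 → ∀ {a b} → φ c a ≡ b → φ c b ≡ a
φ-transpose {c} c<9 {a} eq = trans (cong (φ c) (sym eq)) (φ-involutive c<9 a)

-- Each constructor describes a move from a ∷ b ∷ c ∷ [] onto the graph of `φ`.
data Winning (c a b : ℕ) : Set where
  remove₁ : φ c b < a → Winning c a b
  remove₂ : φ c a < b → Winning c a b
  remove₃ : ∀ {d} → d < c → φ d a ≡ b → Winning c a b
  halve   : φ ⌊ c /2⌋ ⌊ a /2⌋ ≡ ⌊ b /2⌋ → Winning c a b

-- The slices are involutions, so their graphs are symmetric in the first two piles. This lets
-- `Local` treat only b ≥ a.
winning-sym : ∀ {c} → c < 9 → ∀ {a b} → Winning c a b → Winning c b a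
winning-sym c<9 (remove₁ lt)     = remove₂ lt
winning-sym c<9 (remove₂ lt)     = remove₁ lt
winning-sym c<9 (remove₃ d<c eq) = remove₃ d<c (φ-transpose (<-trans d<c c<9) eq)
winning-sym c<9 (halve eq)       = halve (φ-transpose (≤-<-trans (⌊n/2⌋≤n _) c<9) eq)

-- A second pile above `φ c a` can be reduced to it; below, the alternatives listed in `Local` apply
-- with e = b ∸ a.
winning-≤ : ∀ {c} → c < 9 → ∀ {a b} → a ≤ b → b ≢ φ c a → Winning c a b
winning-≤ {c} c<9 {a} {b} a≤b b≢φa with <-cmp b (φ c a)
... | tri≈ _ b≡φa _ = contradiction b≡φa b≢φa
... | tri> _ _ φa<b = remove₂ φa<b
... | tri< b<φa _ _
  with _ , _ , _ , reach ← local c<9 a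
  with reach (∸-monoˡ-< b<φa a≤b) | m+[n∸m]≡n a≤b
... | inj₁ φb<a                  | a+e≡b = remove₁ (subst (λ x → φ c x < a) a+e≡b φb<a)
... | inj₂ (inj₁ (d , d<c , eq)) | a+e≡b = remove₃ d<c (trans eq a+e≡b)
... | inj₂ (inj₂ eq)             | a+e≡b = halve (trans eq (cong ⌊_/2⌋ a+e≡b))

winning : ∀ {c} → c < 9 → ∀ a b → b ≢ φ c a → Winning c a b
winning c<9 a b b≢φa with ≤-total a b
... | inj₁ a≤b = winning-≤ c<9 a≤b b≢φa
... | inj₂ b≤a = winning-sym c<9
  (winning-≤ c<9 b≤a (b≢φa ∘ sym ∘ φ-transpose c<9 ∘ sym))

⌊/2⌋-sum-< : ∀ a b c → Any (0 <_) (a ∷ b ∷ c ∷ []) →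
             ⌊ a /2⌋ + ⌊ b /2⌋ + ⌊ c /2⌋ < a + b + c
⌊/2⌋-sum-< (suc a) b c (here _) =
  +-mono-<-≤ (+-mono-<-≤ (⌊n/2⌋<n a) (⌊n/2⌋≤n b)) (⌊n/2⌋≤n c)
⌊/2⌋-sum-< a (suc b) c (there (here _)) =
  +-mono-<-≤ (+-mono-≤-< (⌊n/2⌋≤n a) (⌊n/2⌋<n b)) (⌊n/2⌋≤n c)
⌊/2⌋-sum-< a b (suc c) (there (there (here _))) =
  +-mono-≤-< (+-mono-≤ (⌊n/2⌋≤n a) (⌊n/2⌋≤n b)) (⌊n/2⌋<n c)

nonempty : ∀ a b c → b ≢ φ c a → Any (0 <_) (a ∷ b ∷ c ∷ [])
nonempty (suc _) _       _       _ = here z<s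
nonempty zero    (suc _) _       _ = there (here z<s)
nonempty zero    zero    (suc _) _ = there (there (here z<s))
nonempty zero    zero    zero    b≢φa = contradiction refl b≢φa

-- Induction on the number of coins

-- n strictly bounds the number of coins. Every move lowers that number, so the mutual recursion
-- descends on n.
𝒫-position : ∀ n {a b c} → c < 9 → a + b + c < n → b ≡ φ c a → 𝒫 (a ∷ b ∷ c ∷ [])
𝒩-position : ∀ n {a b c} → c < 9 → a + b + c < n → b ≢ φ c a → 𝒩 (a ∷ b ∷ c ∷ [])

𝒫-position (suc n) {a} {b} {c} c<9 (s≤s sum≤n) refl
  with _ , distinct , half , _ ← local c<9 a = every-move reply
  where
  -- `half` lets a halving stay on the graph only for a = c = 0. Then `φ 0 0` is 0 as well, no coin
  -- is left, and halving is not a legal move.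
  nonzero : Any (0 <_) (a ∷ φ c a ∷ c ∷ []) → ¬ (a ≡ 0 × c ≡ 0)
  nonzero (here ())                 (refl , refl)
  nonzero (there (here ()))         (refl , refl)
  nonzero (there (there (here ()))) (refl , refl)
  reply : ∀ {q} → (a ∷ φ c a ∷ c ∷ []) ⟶ q → 𝒩 q
  reply (remove Fin.zero m<a) =
    𝒩-position n c<9 (<-≤-trans (+-monoˡ-< c (+-monoˡ-< (φ c a) m<a)) sum≤n)
      -- A smaller first pile with the same partner would contradict the injectivity of the
      -- involution `φ c`.
      (λ eq → <⇒≢ m<a (trans (sym (φ-transpose c<9 (sym eq))) (φ-involutive c<9 a)))
  reply (remove (Fin.suc Fin.zero) m<b) =
    𝒩-position n c<9 (<-≤-trans (+-monoˡ-< c (+-monoʳ-< a m<b)) sum≤n) (<⇒≢ m<b)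
  reply (remove (Fin.suc (Fin.suc Fin.zero)) m<c) =
    𝒩-position n (<-trans m<c c<9) (<-≤-trans (+-monoʳ-< (a + φ c a) m<c) sum≤n)
      (distinct m<c ∘ sym)
  reply (halve any) =
    𝒩-position n (≤-<-trans (⌊n/2⌋≤n c) c<9) (<-≤-trans (⌊/2⌋-sum-< a (φ c a) c any) sum≤n)
      (λ eq → nonzero any (half (sym eq)))

𝒩-position (suc n) {a} {b} {c} c<9 (s≤s sum≤n) b≢φa with winning c<9 a b b≢φa
... | remove₁ φb<a = some-move (_ , remove Fin.zero φb<a ,
  𝒫-position n c<9 (<-≤-trans (+-monoˡ-< c (+-monoˡ-< b φb<a)) sum≤n) (sym (φ-involutive c<9 b)))
... | remove₂ φa<b = some-move (_ , remove (Fin.suc Fin.zero) φa<b ,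
  𝒫-position n c<9 (<-≤-trans (+-monoˡ-< c (+-monoʳ-< a φa<b)) sum≤n) refl)
... | remove₃ d<c eq = some-move (_ , remove (Fin.suc (Fin.suc Fin.zero)) d<c ,
  𝒫-position n (<-trans d<c c<9) (<-≤-trans (+-monoʳ-< (a + b) d<c) sum≤n) (sym eq))
... | halve eq = some-move (_ , halve any ,
  𝒫-position n (≤-<-trans (⌊n/2⌋≤n c) c<9) (<-≤-trans (⌊/2⌋-sum-< a b c any) sum≤n) (sym eq))
  where any = nonempty a b c b≢φa

-- Two winning strategies played against each other would never end, but strategies are
-- well-founded.
𝒫⇒¬𝒩 : ∀ {p} → 𝒫 p → ¬ 𝒩 p
𝒫⇒¬𝒩 (every-move reply) (some-move (_ , p⟶q , 𝒫q)) = 𝒫⇒¬𝒩 𝒫q (reply p⟶q)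

theorem39 : ∀ (a b : ℕ) → 𝒫 (a ∷ b ∷ 8 ∷ []) ⇔ (b ≡ φ₈ a)
theorem39 a b = mk⇔
  (λ 𝒫p → decidable-stable (b ≟ φ₈ a) (𝒫⇒¬𝒩 𝒫p ∘ 𝒩-position _ 8<9 (n<1+n _)))
  (𝒫-position _ 8<9 (n<1+n _))
  where
  8<9 : 8 < 9
  8<9 = n<1+n 8
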